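{- For every $m\in\mathbb{N}$, $$N(2,3,3;2m)=N(1,3,3;m),\qquad t(2,3,3;8m+6)=2\,t(1,3,3;m),\qquad t(2,3,3;32m+27)=4\,t(1,3,3;m).$$ Moreover, for every positive integer $n$ with $n\not\equiv 15\pmod{16}$, $$t(2,3,3;n)=\begin{cases} 4N(1,3,3;n+1)&\text{if } n\equiv 0,1\pmod 4,\\ 2N(1,3,3;n+1)&\text{if } n\equiv 2\pmod 8,\\ N(1,3,3;n+1)&\text{if } n\equiv 6\pmod 8 \text{ or } n\equiv 27\pmod{32},\\ \tfrac85N(1,3,3;n+1)&\text{if } n\equiv 3,7\pmod{16},\\ \tfrac43N(1,3,3;n+1)&\text{if } n\equiv 11\pmod{32}.\end{cases}$$
   Context: For positive integers $a,b,c$ and $n\in\mathbb{N}=\{0,1,2,\dots\}$, $N(a,b,c;n)$ denotes the number of triples $(x,y,z)\in\mathbb{Z}^3$ with $n=ax^2+by^2+cz^2$, and $t(a,b,c;n)$ denotes the number of triples $(x,y,z)\in\mathbb{Z}^3$ with $n=a\frac{x(x+1)}2+b\frac{y(y+1)}2+c\frac{z(z+1)}2$. -}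

module Defs where

open import Data.Nat using (ℕ; suc; _+_; _*_; _/_)
open import Data.Nat.Properties using (_≟_)
open import Data.Integer as ℤ using (ℤ; +_; ∣_∣)
open import Data.List using (List; map; upTo; concatMap; filter; length)
open import Data.Product using (_×_; _,_)

symRange : ℕ → List ℤ
symRange k = map (λ i → (+ i) ℤ.- (+ k)) (upTo (suc (k + k)))

box : ℕ → List (ℤ × ℤ × ℤ)
box k = concatMap (λ x → concatMap (λ y → map (λ z → x , y , z) (symRange k)) (symRange k)) (symRange k)

sq : ℤ → ℕ
sq x = ∣ x ℤ.* x ∣

-- x(x+1)/2, which is a natural number for every integer x
tri : ℤ → ℕ
tri x = ∣ x ℤ.* (x ℤ.+ + 1) ∣ / 2

-- N(a,b,c;n) = #{(x,y,z) ∈ ℤ³ : n = a x² + b y² + c z²}.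
-- Any solution has |x|,|y|,|z| ≤ n (a,b,c ≥ 1), so enumerating [-n,n]³ counts all of them
-- (for a,b,c positive, as in the paper).
N : ℕ → ℕ → ℕ → ℕ → ℕ
N a b c n = length (filter (λ { (x , y , z) → (a * sq x + b * sq y + c * sq z) ≟ n }) (box n))

-- t(a,b,c;n) = #{(x,y,z) ∈ ℤ³ : n = a x(x+1)/2 + b y(y+1)/2 + c z(z+1)/2}.
-- Any solution has x(x+1)/2 ≤ n, hence -(n+1) ≤ x ≤ n, so enumerating [-(n+1),n+1]³ counts all.
t : ℕ → ℕ → ℕ → ℕ → ℕ
t a b c n = length (filter (λ { (x , y , z) → (a * tri x + b * tri y + c * tri z) ≟ n }) (box (suc n)))

{-# OPTIONS --safe #-}
module Submission where

open import Defs
open import Data.Bool using (Bool; true; false; not)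
open import Data.Empty using (⊥-elim)
open import Data.Nat as ℕ using (ℕ; zero; suc; z≤n; s≤s)
open import Data.Nat.Base using (NonZero)
import Data.Nat.DivMod as ℕ
import Data.Nat.Properties as ℕ
import Data.Nat.Solver as ℕ
open import Data.Integer as ℤ using (ℤ; +_; -[1+_]; ∣_∣)
import Data.Integer.Properties as ℤ
import Data.Integer.DivMod as ℤ
open import Data.Integer.Divisibility.Signed using (_∣?_; divides)
open import Data.Integer.Solver using (module +-*-Solver)
open import Data.List using (List; []; _∷_; _++_; map; concatMap; filter; length)
open import Data.List.Properties using (length-map; length-++)
open import Data.List.Membership.Propositional using (_∈_)
open import Data.List.Membership.Propositional.Properties
  using (∈-map⁺; ∈-map⁻; ∈-++⁺ˡ; ∈-++⁺ʳ; ∈-++⁻; ∈-concat⁺′; ∈-concat⁻′; ∈-filter⁺; ∈-filter⁻; ∈-upTo⁺)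
open import Data.List.Membership.Propositional.Properties.WithK using (unique∧set⇒bag)
open import Data.List.Relation.Binary.BagAndSetEquality using (∼bag⇒↭)
open import Data.List.Relation.Binary.Permutation.Propositional
  using (_↭_; ↭-refl; ↭-sym; ↭-trans; prep; ↭⇒↭ₛ)
open import Data.List.Relation.Binary.Permutation.Propositional.Properties
  using (↭-length; ∈-resp-↭; shift)
open import Data.List.Relation.Binary.Permutation.Setoid.Properties using (Unique-resp-↭)
import Data.List.Relation.Unary.All as All
import Data.List.Relation.Unary.All.Properties as All
open import Data.List.Relation.Unary.Any using (here)
open import Data.List.Relation.Unary.AllPairs using ([]; _∷_)
open import Data.List.Relation.Unary.Unique.Propositional using (Unique)
import Data.List.Relation.Unary.Unique.Propositional.Properties as Unique
open import Data.Product using (_×_; _,_; proj₁; proj₂; ∃; ∃₂)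
open import Data.Sum using (_⊎_; inj₁; inj₂; [_,_]′)
open import Function using (_∘_; id; _⇔_; mk⇔; Equivalence)
open import Relation.Nullary using (¬_)
open import Relation.Nullary.Decidable using (False; toWitnessFalse)
open import Relation.Unary using (Decidable)
open import Relation.Binary.PropositionalEquality

-- Solutions of x² + 3y² + 3z² = M are sorted into octants by the parities of x, y, z. With M = n + 1,
-- t(2,3,3;n) counts the solutions of 2X² + 3Y² + 3Z² = 8M in odd integers; writing Y = U + V and
-- Z = U - V, it is twice the number of solutions of X² + 3U² + 3V² = 4M with X, U odd and V even.
-- As X² + 3U² = 4(a² + 3b²) with X ± U√-3 = (1 + √-3)(a + b√-3) for one choice of the sign, this gives
-- t(2,3,3;n) = 4 #{(a,b,v) : a² + 3b² + 3v² = M, a + b odd}. Modulo 4 and 8 most octants are empty,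
-- exchanging y and z identifies others, and for M ≡ 7 (mod 8) the same multiplication by 1 + √-3 shows
-- that the all-odd octant, which t(1,3,3) counts, is twice the octant (even, even, odd). For M = 4M′ the
-- octants yield N(4M′) = N(M′) + t(M′ - 1) and t(4M′ - 1) = 2t(M′ - 1), whence the ratios 8/5 and 4/3.

-- Counting the solutions of a predicate

unique-++⁻ : ∀ {A : Set} (xs : List A) {ys} → Unique (xs ++ ys) → Unique xs × Unique ys
unique-++⁻ []       ys!         = [] , ys!
unique-++⁻ (x ∷ xs) (x∉ ∷ xsys!) with unique-++⁻ xs xsys!
... | xs! , ys! = All.++⁻ˡ xs x∉ ∷ xs! , ys!

-- The predicates range over the infinite type ℤ³, so finiteness comes as data: a duplicate-free
-- list of all solutions. Equalities between values of `N` and `t` then follow from bijections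
-- between predicates, whatever the order of an enumeration.
record Count {A : Set} (P : A → Set) (n : ℕ) : Set where
  field
    elements    : List A
    unique      : Unique elements
    sound       : ∀ {x} → x ∈ elements → P x
    complete    : ∀ {x} → P x → x ∈ elements
    cardinality : length elements ≡ n
open Count

-- Duplicate-free lists with the same members are equal as bags, hence permutations of each other.
count-unique : ∀ {A : Set} {P Q : A → Set} {m n} → (∀ x → P x ⇔ Q x) → Count P m → Count Q n → m ≡ n
count-unique {m = m} {n} P⇔Q p q = begin
  m                   ≡⟨ cardinality p ⟨
  length (elements p) ≡⟨ ↭-length (∼bag⇒↭ (unique∧set⇒bag (unique p) (unique q)
                           (mk⇔ (λ x∈p → complete q (Equivalence.to (P⇔Q _) (sound p x∈p)))
                                (λ x∈q → complete p (Equivalence.from (P⇔Q _) (sound q x∈q)))))) ⟩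
  length (elements q) ≡⟨ cardinality q ⟩
  n                   ∎
  where open ≡-Reasoning

count-empty : ∀ {A : Set} {P : A → Set} {n} → (∀ x → ¬ P x) → Count P n → n ≡ 0
count-empty ¬P c with elements c | sound c | cardinality c
... | []    | _ | eq = sym eq
... | _ ∷ _ | s | _  = ⊥-elim (¬P _ (s (here refl)))

transport : ∀ {A B : Set} {P : A → Set} {Q : B → Set} {n}
            (f : B → A) (g : A → B) → (∀ y → f (g y) ≡ y) → (∀ x → g (f x) ≡ x) →
            (∀ x → P (f x) ⇔ Q x) → Count P n → Count Q n
transport {P = P} {Q} f g fg gf Pf⇔Q c = record
  { elements    = map g (elements c)
  ; unique      = Unique.map⁺ (λ {x} {y} e → trans (sym (fg x)) (trans (cong f e) (fg y))) (unique c)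
  ; sound       = λ x∈ → let y , y∈ , x≡gy = ∈-map⁻ g x∈ in
                    Equivalence.to (Pf⇔Q _)
                      (subst P (sym (trans (cong f x≡gy) (fg y))) (sound c y∈))
  ; complete    = λ {x} q → subst (_∈ map g (elements c)) (gf x)
                    (∈-map⁺ g (complete c (Equivalence.from (Pf⇔Q x) q)))
  ; cardinality = trans (length-map g (elements c)) (cardinality c)
  }

module _ {A B C : Set} (f : A → C) (g : B → C) where

  -- The list is partitioned by preimages rather than by a filter, so that the two parts come out in
  -- the source types `A` and `B`, ready to be counted there.
  ↭-images : (∀ z → (∃ λ x → z ≡ f x) ⊎ (∃ λ y → z ≡ g y)) →
             ∀ zs → ∃₂ λ xs ys → map f xs ++ map g ys ↭ zs
  ↭-images cover [] = [] , [] , ↭-refl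
  ↭-images cover (z ∷ zs) with cover z | ↭-images cover zs
  ... | inj₁ (x , refl) | xs , ys , ↭zs = x ∷ xs , ys , prep z ↭zs
  ... | inj₂ (y , refl) | xs , ys , ↭zs =
    xs , y ∷ ys , ↭-trans (shift z (map f xs) (map g ys)) (prep z ↭zs)

  count-split : (∀ x x′ → f x ≡ f x′ → x ≡ x′) → (∀ y y′ → g y ≡ g y′ → y ≡ y′) →
                (∀ x y → f x ≢ g y) →
                (∀ z → (∃ λ x → z ≡ f x) ⊎ (∃ λ y → z ≡ g y)) →
                ∀ {P n} → Count P n →
                ∃₂ λ p q → n ≡ p ℕ.+ q × Count (P ∘ f) p × Count (P ∘ g) q
  count-split f-inj g-inj f≢g cover {P} c with ↭-images cover (elements c)
  ... | xs , ys , ↭zs =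
    length xs , length ys ,
    trans (sym (cardinality c)) (trans (sym (↭-length ↭zs))
      (trans (length-++ (map f xs)) (cong₂ ℕ._+_ (length-map f xs) (length-map g ys)))) ,
    record
      { elements    = xs
      ; unique      = Unique.map⁻ (proj₁ uniques)
      ; sound       = λ x∈ → sound c (∈-resp-↭ ↭zs (∈-++⁺ˡ (∈-map⁺ f x∈)))
      ; complete    = λ Pfx → [ (λ ∈f → let _ , x∈ , e = ∈-map⁻ f ∈f in
                                  subst (_∈ xs) (sym (f-inj _ _ e)) x∈)
                              , (λ ∈g → let _ , _ , e = ∈-map⁻ g ∈g in ⊥-elim (f≢g _ _ e))
                              ]′ (image Pfx)
      ; cardinality = refl
      } ,
    record
      { elements    = ys
      ; unique      = Unique.map⁻ (proj₂ uniques)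
      ; sound       = λ y∈ → sound c (∈-resp-↭ ↭zs (∈-++⁺ʳ (map f xs) (∈-map⁺ g y∈)))
      ; complete    = λ Pgy → [ (λ ∈f → let _ , _ , e = ∈-map⁻ f ∈f in ⊥-elim (f≢g _ _ (sym e)))
                              , (λ ∈g → let _ , y∈ , e = ∈-map⁻ g ∈g in
                                  subst (_∈ ys) (sym (g-inj _ _ e)) y∈)
                              ]′ (image Pgy)
      ; cardinality = refl
      }
    where
    uniques = unique-++⁻ (map f xs) (Unique-resp-↭ (setoid _) (↭⇒↭ₛ (↭-sym ↭zs)) (unique c))
    image : ∀ {z} → P z → z ∈ map f xs ⊎ z ∈ map g ys
    image Pz = ∈-++⁻ (map f xs) (∈-resp-↭ (↭-sym ↭zs) (complete c Pz))

concatMap-unique : ∀ {A B : Set} (f : A → List B) →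
                   (∀ x → Unique (f x)) → (∀ {x x′ y} → y ∈ f x → y ∈ f x′ → x ≡ x′) →
                   ∀ {xs} → Unique xs → Unique (concatMap f xs)
concatMap-unique f f! inj []                  = []
concatMap-unique f f! inj {x ∷ xs} (x∉ ∷ xs!) =
  Unique.++⁺ (f! x) (concatMap-unique f f! inj xs!) λ (y∈fx , y∈rest) →
    let ys , y∈ys , ys∈ = ∈-concat⁻′ (map f xs) y∈rest
        x′ , x′∈ , ys≡  = ∈-map⁻ f ys∈
    in All.lookup x∉ x′∈ (inj y∈fx (subst (_ ∈_) ys≡ y∈ys))

count-filter : ∀ {A : Set} {P : A → Set} (P? : Decidable P) {xs} → Unique xs →
               (∀ {x} → P x → x ∈ xs) → Count P (length (filter P? xs))
count-filter P? {xs} xs! ∈xs = record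
  { elements    = filter P? xs
  ; unique      = Unique.filter⁺ P? xs!
  ; sound       = λ x∈ → proj₂ (∈-filter⁻ P? {xs = xs} x∈)
  ; complete    = λ p → ∈-filter⁺ P? (∈xs p) p
  ; cardinality = refl
  }

count-cong : ∀ {A : Set} {P Q : A → Set} {n} → (∀ x → P x ⇔ Q x) → Count P n → Count Q n
count-cong {P = P} = transport {P = P} id id (λ _ → refl) (λ _ → refl)

-- Sums over the eight parity octants

open ℕ.+-*-Solver using () renaming (solve to solveℕ; _:+_ to _⊕_; _:*_ to _⊗_; _:=_ to _⊜_; con to conℕ)

Σ₂ : (Bool → ℕ) → ℕ
Σ₂ c = c false ℕ.+ c true

Σ₂-cong : ∀ {f g} → (∀ α → f α ≡ g α) → Σ₂ f ≡ Σ₂ g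
Σ₂-cong f≗g = cong₂ ℕ._+_ (f≗g false) (f≗g true)

total : (Bool → Bool → Bool → ℕ) → ℕ
total c = Σ₂ λ α → Σ₂ λ β → Σ₂ (c α β)

module _ (c : Bool → Bool → Bool → ℕ) where

  -- The share of the octants in which x and y have opposite parity, that is, x + y is odd; the
  -- parity of z is free.
  mixed : ℕ
  mixed = Σ₂ λ β → Σ₂ (c (not β) β)

  module _ (c000 : c false false false ≡ 0) (c101 : c true false true ≡ 0) (c110 : c true true false ≡ 0) where

    -- The pattern for M ≡ 1 and M ≡ 2 (mod 4): all four octants with x + y even are empty.
    total≡mixed : c false false true ≡ 0 → c true true true ≡ 0 → total c ≡ mixed
    total≡mixed c001 c111 rewrite c000 | c001 | c101 | c110 | c111 =
      solveℕ 3 (λ a b d → a ⊕ b ⊕ (d ⊕ conℕ 0 ⊕ conℕ 0) ⊜ d ⊕ conℕ 0 ⊕ (a ⊕ b)) refl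
        (c false true false) (c false true true) (c true false false)

    module _ (c100 : c true false false ≡ 0) (c011 : c false true true ≡ 0)
             (sym01 : c false true false ≡ c false false true) where

      mixed≡ : mixed ≡ c false false true
      mixed≡ rewrite c100 | c101 | c011 | sym01 = ℕ.+-identityʳ _

      -- The pattern for M ≡ 3 (mod 4): with parities written as bits, the octants 001, 010 and 111
      -- survive, and of these only 010 lies in `mixed`.
      total≡2*mixed : total c ≡ mixed ℕ.+ mixed ℕ.+ c true true true
      total≡2*mixed rewrite c000 | c100 | c101 | c110 | c011 | sym01 =
        solveℕ 2 (λ a b → a ⊕ (a ⊕ conℕ 0) ⊕ b ⊜ a ⊕ conℕ 0 ⊕ (a ⊕ conℕ 0) ⊕ b) refl
          (c false false true) (c true true true)

  -- The pattern for M ≡ 0 (mod 4): the octants 000, 101 and 110 survive, and of these only 101 lies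
  -- in `mixed`.
  total-0 : c false false true ≡ 0 → c false true false ≡ 0 → c false true true ≡ 0 →
            c true false false ≡ 0 → c true true true ≡ 0 → c true false true ≡ c true true false →
            total c ≡ c false false false ℕ.+ (c true true false ℕ.+ c true true false)
  total-0 c001 c010 c011 c100 c111 sym10 rewrite c001 | c010 | c011 | c100 | c111 | sym10 =
    solveℕ 2 (λ a b → a ⊕ conℕ 0 ⊕ conℕ 0 ⊕ (b ⊕ (b ⊕ conℕ 0)) ⊜ a ⊕ (b ⊕ b)) refl
      (c false false false) (c true true false)

  mixed-0 : c true false false ≡ 0 → c false true false ≡ 0 → c false true true ≡ 0 →
            c true false true ≡ c true true false → mixed ≡ c true true false
  mixed-0 c100 c010 c011 sym10 rewrite c100 | c010 | c011 | sym10 = ℕ.+-identityʳ _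

-- Parity classes of integer triples

module Integral where

  open import Data.Integer using (_+_; _*_; _-_; -_)
  open +-*-Solver

  Triple : Set
  Triple = ℤ × ℤ × ℤ

  bit : Bool → ℤ
  bit false = + 0
  bit true  = + 1

  lift : Bool → ℤ → ℤ
  lift α x = + 2 * x + bit α

  form : ℤ → ℤ → ℤ → ℤ → ℤ → ℤ → ℤ
  form a b c x y z = a * (x * x) + b * (y * y) + c * (z * z)

  ⟨1,3,3⟩ : Triple → ℤ
  ⟨1,3,3⟩ (x , y , z) = form (+ 1) (+ 3) (+ 3) x y z

  ⟨2,3,3⟩ : Triple → ℤ
  ⟨2,3,3⟩ (x , y , z) = form (+ 2) (+ 3) (+ 3) x y z

  -- `liftₚ` and `formₚ` are `lift` and `form` in the syntax of the ring solver. The parity is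
  -- itself a polynomial, so that one identity can serve all parities at once.
  liftₚ : ∀ {n} → Polynomial n → Polynomial n → Polynomial n
  liftₚ a x = con (+ 2) :* x :+ a

  formₚ : ∀ {n} → ℤ → Polynomial n → Polynomial n → Polynomial n → Polynomial n
  formₚ a x y z = con a :* (x :* x) :+ con (+ 3) :* (y :* y) :+ con (+ 3) :* (z :* z)

  no-multiple : ∀ m d {_ : False (m ∣? d)} q → q * m ≢ d
  no-multiple m d {m∤d} q q*m≡d = toWitnessFalse m∤d (divides q (sym q*m≡d))

  -- The difference s - r would equal (p - q) * m. For closed m, r and s the implicit argument is
  -- settled by evaluating the divisibility test.
  residues-clash : ∀ m r s {_ : False (m ∣? (s - r))} {A} p q → A ≡ m * p + r → A ≢ m * q + s
  residues-clash m r s {m∤} p q refl e = no-multiple m (s - r) {m∤} (p - q) (begin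
    (p - q) * m           ≡⟨ solve 4 (λ m r p q → (p :- q) :* m := m :* p :+ r :- m :* q :- r) refl m r p q ⟩
    m * p + r - m * q - r ≡⟨ cong (λ w → w - m * q - r) e ⟩
    m * q + s - m * q - r ≡⟨ solve 4 (λ m r s q → m :* q :+ s :- m :* q :- r := s :- r) refl m r s q ⟩
    s - r                 ∎)
    where open ≡-Reasoning

  parity : ∀ z → ∃₂ λ α k → z ≡ lift α k
  parity z with z ℤ.%ℕ 2 | z ℤ./ℕ 2 | ℤ.a≡a%ℕn+[a/ℕn]*n z 2 | ℤ.n%ℕd<d z 2
  ... | 0 | k | e | _ = false , k , trans e (trans (ℤ.+-comm (+ 0) (k * + 2)) (cong (_+ + 0) (ℤ.*-comm k (+ 2))))
  ... | 1 | k | e | _ = true  , k , trans e (trans (ℤ.+-comm (+ 1) (k * + 2)) (cong (_+ + 1) (ℤ.*-comm k (+ 2))))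
  ... | suc (suc _) | _ | _ | s≤s (s≤s ())

  lift-injective : ∀ α x y → lift α x ≡ lift α y → x ≡ y
  lift-injective α x y e = ℤ.*-cancelˡ-≡ (+ 2) x y (trans (peel x) (trans (cong (_- bit α) e) (sym (peel y))))
    where
    peel : ∀ x → + 2 * x ≡ lift α x - bit α
    peel x = solve 2 (λ a x → con (+ 2) :* x := liftₚ a x :- a) refl (bit α) x

  even≢odd : ∀ x y → lift false x ≢ lift true y
  even≢odd x y = residues-clash (+ 2) (+ 0) (+ 1) x y refl

  triple-≡ : ∀ {x x′ y y′ z z′ : ℤ} → x ≡ x′ → y ≡ y′ → z ≡ z′ → (x , y , z) ≡ (x′ , y′ , z′)
  triple-≡ refl refl refl = refl

  on-first : Bool → Triple → Triple
  on-first α (x , y , z) = lift α x , y , z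

  on-first-injective : ∀ α v w → on-first α v ≡ on-first α w → v ≡ w
  on-first-injective α (x , y , z) (x′ , y′ , z′) e = cong₂ _,_ (lift-injective α x x′ (cong proj₁ e)) (cong proj₂ e)

  on-first-cover : ∀ v → (∃ λ w → v ≡ on-first false w) ⊎ (∃ λ w → v ≡ on-first true w)
  on-first-cover (x , y , z) with parity x
  ... | false , k , refl = inj₁ ((k , y , z) , refl)
  ... | true  , k , refl = inj₂ ((k , y , z) , refl)

  on-first-disjoint : ∀ v w → on-first false v ≢ on-first true w
  on-first-disjoint (x , _) (x′ , _) e = even≢odd x x′ (cong proj₁ e)

  bisect : ∀ (P : Triple → Set) {n} → Count P n →
           ∃ λ c → n ≡ Σ₂ c × ∀ α → Count (P ∘ on-first α) (c α)
  bisect P {n} count =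
    let p , q , n≡p+q , even , odd = count-split (on-first false) (on-first true)
          (on-first-injective false) (on-first-injective true)
          on-first-disjoint on-first-cover {P} {n} count
    in (λ { false → p ; true → q }) , n≡p+q , λ { false → even ; true → odd }

  same-value : ∀ {A B c : ℤ} → A ≡ B → (A ≡ c) ⇔ (B ≡ c)
  same-value A≡B = mk⇔ (trans (sym A≡B)) (trans A≡B)

  same-multiple : ∀ k .{{_ : ℤ.NonZero k}} {A B c} → A ≡ k * B → (A ≡ k * c) ⇔ (B ≡ c)
  same-multiple k {A} {B} {c} A≡kB = mk⇔ (λ A≡kc → ℤ.*-cancelˡ-≡ k B c (trans (sym A≡kB) A≡kc))
                                         (λ B≡c → trans A≡kB (cong (k *_) B≡c))

  -- `bisect` acts on the first coordinate only. Rotations bring the other coordinates to the front,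
  -- and three of them restore the order.
  rotate : ∀ (P : Triple → Set) {n} → Count P n → Count (λ (x , y , z) → P (z , x , y)) n
  rotate P = transport {P = P} (λ (x , y , z) → z , x , y) (λ (x , y , z) → y , z , x)
                 (λ _ → refl) (λ _ → refl) (λ _ → mk⇔ id id)

  lift³ : Bool → Bool → Bool → Triple → Triple
  lift³ α β γ (x , y , z) = lift α x , lift β y , lift γ z

  bisect² : ∀ (P : Triple → Set) {n} → Count P n →
            ∃ λ c → n ≡ Σ₂ (λ α → Σ₂ (c α)) ×
                    ∀ α β → Count (λ ((x , y , z) : Triple) → P (lift α x , lift β y , z)) (c α β)
  bisect² P count =
    let _ , n≡ , along-x = bisect P count
        Px = λ α (x , y , z) → P (lift α z , x , y)
        along-y = λ α → bisect (Px α) (rotate (P ∘ on-first α) (along-x α))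
        Pxy = λ α β (x , y , z) → P (lift α y , lift β z , x)
    in (λ α β → proj₁ (along-y α) β) ,
       trans n≡ (Σ₂-cong λ α → proj₁ (proj₂ (along-y α))) ,
       λ α β → rotate (Pxy α β) (rotate (Px α ∘ on-first β) (proj₂ (proj₂ (along-y α)) β))

  octants : ∀ (P : Triple → Set) {n} → Count P n →
            ∃ λ c → n ≡ Σ₂ (λ α → Σ₂ (λ β → Σ₂ (c α β))) ×
                    ∀ α β γ → Count (P ∘ lift³ α β γ) (c α β γ)
  octants P count =
    let _ , n≡ , along-xy = bisect² P count
        Pxy = λ α β (x , y , z) → P (lift α x , lift β y , z)
        Pxy′ = λ α β (x , y , z) → P (lift α y , lift β z , x)
        along-z = λ α β → bisect (Pxy′ α β)
          (rotate (λ (x , y , z) → Pxy α β (z , x , y)) (rotate (Pxy α β) (along-xy α β)))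
    in (λ α β → proj₁ (along-z α β)) ,
       trans n≡ (Σ₂-cong λ α → Σ₂-cong λ β → proj₁ (proj₂ (along-z α β))) ,
       λ α β γ → rotate (Pxy′ α β ∘ on-first γ) (proj₂ (proj₂ (along-z α β)) γ)

  Rep : (Triple → ℤ) → ℤ → Triple → Set
  Rep q M v = q v ≡ M

  Octant : Bool → Bool → Bool → ℤ → Triple → Set
  Octant α β γ = Rep (⟨1,3,3⟩ ∘ lift³ α β γ)

  octant-sym : ∀ {M m n} α β γ → Count (Octant α β γ M) m → Count (Octant α γ β M) n → m ≡ n
  octant-sym {M} α β γ c = count-unique (λ _ → mk⇔ id id)
    (transport {P = Octant α β γ M} {Q = Octant α γ β M}
      (λ (x , y , z) → x , z , y) (λ (x , y , z) → x , z , y) (λ _ → refl) (λ _ → refl)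
      (λ (x , y , z) → same-value (solve 6 (λ a b c x y z →
        formₚ (+ 1) (liftₚ a x) (liftₚ b z) (liftₚ c y) := formₚ (+ 1) (liftₚ a x) (liftₚ c y) (liftₚ b z))
        refl (bit α) (bit β) (bit γ) x y z))
      c)

  -- Since (2x + a)² = 4(x² + ax) + a², the form modulo 4 depends only on the parities, and it may
  -- be evaluated at the bits themselves.
  octant-empty : ∀ {M n} α β γ s {_ : False (+ 4 ∣? (s - ⟨1,3,3⟩ (bit α , bit β , bit γ)))} k →
                 M ≡ + 4 * k + s → Count (Octant α β γ M) n → n ≡ 0
  octant-empty α β γ s {4∤} k M≡ = count-empty λ (x , y , z) e →
    residues-clash (+ 4) (⟨1,3,3⟩ (bit α , bit β , bit γ)) s {4∤}
      (x * x + bit α * x + + 3 * (y * y + bit β * y) + + 3 * (z * z + bit γ * z)) k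
      (solve 6 (λ a b c x y z →
        formₚ (+ 1) (liftₚ a x) (liftₚ b y) (liftₚ c z) :=
        con (+ 4) :* (x :* x :+ a :* x :+ con (+ 3) :* (y :* y :+ b :* y) :+ con (+ 3) :* (z :* z :+ c :* z))
          :+ formₚ (+ 1) a b c)
        refl (bit α) (bit β) (bit γ) x y z)
      (trans e M≡)

  -- Linear substitutions between the forms

  x-y+y≡x : ∀ x y → x - y + y ≡ x
  x-y+y≡x = solve 2 (λ x y → x :- y :+ y := x) refl

  x+y-y≡x : ∀ x y → x + y - y ≡ x
  x+y-y≡x = solve 2 (λ x y → x :+ y :- y := x) refl

  x-[x-y]≡y : ∀ x y → x - (x - y) ≡ y
  x-[x-y]≡y = solve 2 (λ x y → x :- (x :- y) := y) refl

  x+y-x≡y : ∀ x y → x + y - x ≡ y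
  x+y-x≡y = solve 2 (λ x y → x :+ y :- x := y) refl

  x+[y-x]≡y : ∀ x y → x + (y - x) ≡ y
  x+[y-x]≡y = solve 2 (λ x y → x :+ (y :- x) := y) refl

  -1-[-1-x]≡x : ∀ x → - + 1 - (- + 1 - x) ≡ x
  -1-[-1-x]≡x = solve 1 (λ x → con (- + 1) :- (con (- + 1) :- x) := x) refl

  -- The difference k = y - z replaces z and is split by parity. When y and z encode the odd numbers
  -- Y = 2y + 1 and Z = 2z + 1, it is (Y - Z)/2.
  bisect-y-z : ∀ (P : Triple → Set) {n} → Count P n →
               ∃ λ c → n ≡ Σ₂ c × ∀ α → Count (λ ((k , x , y) : Triple) → P (x , y , y - lift α k)) (c α)
  bisect-y-z P count = bisect (λ (k , x , y) → P (x , y , y - k))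
    (transport {P = P} (λ (k , x , y) → x , y , y - k) (λ (x , y , z) → y - z , x , y)
      (λ (x , y , z) → triple-≡ refl refl (x-[x-y]≡y y z))
      (λ (k , x , y) → triple-≡ (x-[x-y]≡y y k) refl refl)
      (λ _ → mk⇔ id id) count)

  -- The value 8M is written `+ 2 * (+ 4 * M)` so that the factor 2 produced by Y = U + V, Z = U - V
  -- cancels and leaves `+ 4 * M`.
  OddRep : ℤ → Triple → Set
  OddRep M = Rep (⟨2,3,3⟩ ∘ lift³ true true true) (+ 2 * (+ 4 * M))

  -- For odd Y and Z exactly one of (Y ± Z)/2 is odd; with U this one and V the other, 3Y² + 3Z² = 6(U² + V²).
  OddRep-halves : ∀ {M τ h} → Count (OddRep M) τ → Count (Octant true true false (+ 4 * M)) h → τ ≡ h ℕ.+ h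
  OddRep-halves {M} {τ} {h} countT countO with bisect-y-z (OddRep M) countT
  ... | c , τ≡ , pieces = trans τ≡ (cong₂ ℕ._+_ (count-unique (λ _ → mk⇔ id id) even countO)
                                                (count-unique (λ _ → mk⇔ id id) odd countO))
    where
    Piece : Bool → Triple → Set
    Piece α (k , x , y) = OddRep M (x , y , y - lift α k)

    -- Here (Y - Z)/2 = 2k is even and serves as V, with U = (Y + Z)/2 = 2(y - k) + 1; in `odd` the
    -- roles are exchanged.
    even : Count (Octant true true false (+ 4 * M)) (c false)
    even = transport {P = Piece false} (λ (x , u , v) → v , x , u + v) (λ (k , x , y) → x , y - k , k)
      (λ (k , x , y) → triple-≡ refl refl (x-y+y≡x y k))
      (λ (x , u , v) → triple-≡ refl (x+y-y≡x u v) refl)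
      (λ (x , u , v) → same-multiple (+ 2) (solve 3 (λ x u v →
        formₚ (+ 2) (liftₚ (con (+ 1)) x) (liftₚ (con (+ 1)) (u :+ v))
          (liftₚ (con (+ 1)) (u :+ v :- liftₚ (con (+ 0)) v)) :=
        con (+ 2) :* formₚ (+ 1) (liftₚ (con (+ 1)) x) (liftₚ (con (+ 1)) u) (liftₚ (con (+ 0)) v))
        refl x u v))
      (pieces false)

    odd : Count (Octant true true false (+ 4 * M)) (c true)
    odd = transport {P = Piece true} (λ (x , u , v) → u , x , u + v) (λ (k , x , y) → x , k , y - k)
      (λ (k , x , y) → triple-≡ refl refl (x+[y-x]≡y k y))
      (λ (x , u , v) → triple-≡ refl refl (x+y-x≡y u v))
      (λ (x , u , v) → same-multiple (+ 2) (solve 3 (λ x u v →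
        formₚ (+ 2) (liftₚ (con (+ 1)) x) (liftₚ (con (+ 1)) (u :+ v))
          (liftₚ (con (+ 1)) (u :+ v :- liftₚ (con (+ 1)) u)) :=
        con (+ 2) :* formₚ (+ 1) (liftₚ (con (+ 1)) x) (liftₚ (con (+ 1)) u) (liftₚ (con (+ 0)) v))
        refl x u v))
      (pieces true)

  -- An even value of 2x² + 3y² + 3z² forces y and z to have the same parity; then y = u + v and z =
  -- u - v turn the form into 2(x² + 3u² + 3v²).
  ⟨2,3,3⟩-even : ∀ {M n r} → Count (Rep ⟨2,3,3⟩ (+ 2 * M)) n → Count (Rep ⟨1,3,3⟩ M) r → n ≡ r
  ⟨2,3,3⟩-even {M} {n} {r} count countR with bisect-y-z (Rep ⟨2,3,3⟩ (+ 2 * M)) count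
  ... | c , n≡ , pieces = trans n≡ (trans (cong₂ ℕ._+_ (count-unique (λ _ → mk⇔ id id) even countR)
                                                        (count-empty odd (pieces true)))
                                          (ℕ.+-identityʳ r))
    where
    Piece : Bool → Triple → Set
    Piece α (k , x , y) = Rep ⟨2,3,3⟩ (+ 2 * M) (x , y , y - lift α k)

    even : Count (Rep ⟨1,3,3⟩ M) (c false)
    even = transport {P = Piece false} (λ (x , u , v) → v , x , u + v) (λ (k , x , y) → x , y - k , k)
      (λ (k , x , y) → triple-≡ refl refl (x-y+y≡x y k))
      (λ (x , u , v) → triple-≡ refl (x+y-y≡x u v) refl)
      (λ (x , u , v) → same-multiple (+ 2) (solve 3 (λ x u v →
        formₚ (+ 2) x (u :+ v) (u :+ v :- liftₚ (con (+ 0)) v) := con (+ 2) :* formₚ (+ 1) x u v)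
        refl x u v))
      (pieces false)

    odd : ∀ v → ¬ Piece true v
    odd (k , x , y) e = residues-clash (+ 2) (+ 1) (+ 0)
      (x * x + + 3 * (y * y) - + 3 * (y * lift true k) + + 6 * (k * k + k) + + 1) M
      (solve 3 (λ k x y →
        formₚ (+ 2) x y (y :- liftₚ (con (+ 1)) k) :=
        con (+ 2) :* (x :* x :+ con (+ 3) :* (y :* y) :- con (+ 3) :* (y :* liftₚ (con (+ 1)) k)
          :+ con (+ 6) :* (k :* k :+ k) :+ con (+ 1)) :+ con (+ 1))
        refl k x y)
      (trans e (solve 1 (λ m → con (+ 2) :* m := con (+ 2) :* m :+ con (+ 0)) refl M))

  -- For X = 2x + 1 and U = 2u + 1, one of X ± U is divisible by 4; this makes X ± U√-3 the product
  -- of 1 + √-3 and some a + b√-3 with a + b odd, and so X² + 3U² = 4(a² + 3b²).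
  Doubled : Bool → ℤ → Triple → Set
  Doubled γ = Rep λ (u , b , w) → ⟨1,3,3⟩ (+ 2 * (lift true u - b) , + 2 * b , lift γ w)

  -- The parity of k = (X - U)/2 decides which of X - U and X + U is divisible by 4. Both classes
  -- are matched with the same `Doubled` set, whence the factor 2.
  octant-halves : ∀ {M h} γ → Count (Octant true true γ M) h →
                  ∃ λ d → h ≡ d ℕ.+ d × Count (Doubled γ M) d
  octant-halves {M} {h} γ count with bisect (λ (k , u , w) → Octant true true γ M (u + k , u , w))
    (transport {P = Octant true true γ M} (λ (k , u , w) → u + k , u , w) (λ (x , u , w) → x - u , u , w)
      (λ (x , u , w) → triple-≡ (x+[y-x]≡y u x) refl refl)
      (λ (k , u , w) → triple-≡ (x+y-x≡y u k) refl refl)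
      (λ _ → mk⇔ id id) count)
  ... | c , h≡ , pieces = c false , trans h≡ (cong (c false ℕ.+_) (count-unique (λ _ → mk⇔ id id) odd even)) , even
    where
    Piece : Bool → Triple → Set
    Piece α (k , u , w) = Octant true true γ M (u + lift α k , u , w)

    -- With X = U + 4k take b = -k = (U - X)/4, so that a = U - b satisfies (1 + √-3)(a + b√-3) = X
    -- + U√-3.
    even : Count (Doubled γ M) (c false)
    even = transport {P = Piece false} (λ (u , b , w) → - b , u , w) (λ (k , u , w) → u , - k , w)
      (λ (k , u , w) → triple-≡ (solve 1 (λ k → :- (:- k) := k) refl k) refl refl)
      (λ (u , b , w) → triple-≡ refl (solve 1 (λ k → :- (:- k) := k) refl b) refl)
      (λ (u , b , w) → same-value (solve 4 (λ c u b w →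
        formₚ (+ 1) (liftₚ (con (+ 1)) (u :+ liftₚ (con (+ 0)) (:- b))) (liftₚ (con (+ 1)) u) (liftₚ c w) :=
        formₚ (+ 1) (con (+ 2) :* (liftₚ (con (+ 1)) u :- b)) (con (+ 2) :* b) (liftₚ c w))
        refl (bit γ) u b w))
      (pieces false)

    -- Now X + U is divisible by 4. Changing U to -U, that is u to -1 - u, leads back to the formula
    -- b = (U - X)/4.
    odd : Count (Doubled γ M) (c true)
    odd = transport {P = Piece true} (λ (u , b , w) → u - b , - + 1 - u , w) (λ (k , u , w) → - + 1 - u , - + 1 - u - k , w)
      (λ (k , u , w) → triple-≡ (x-[x-y]≡y (- + 1 - u) k) (-1-[-1-x]≡x u) refl)
      (λ (u , b , w) → triple-≡ (-1-[-1-x]≡x u)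
        (solve 2 (λ u b → con (- + 1) :- (con (- + 1) :- u) :- (u :- b) := b) refl u b) refl)
      (λ (u , b , w) → same-value (solve 4 (λ c u b w →
        formₚ (+ 1) (liftₚ (con (+ 1)) (con (- + 1) :- u :+ liftₚ (con (+ 1)) (u :- b)))
          (liftₚ (con (+ 1)) (con (- + 1) :- u)) (liftₚ c w) :=
        formₚ (+ 1) (con (+ 2) :* (liftₚ (con (+ 1)) u :- b)) (con (+ 2) :* b) (liftₚ c w))
        refl (bit γ) u b w))
      (pieces true)

  -- For a = lift true u - b, the sum a + b = 2u + 1 ranges over all odd numbers.
  OddSum : ℤ → Triple → Set
  OddSum = Rep λ (u , b , w) → ⟨1,3,3⟩ (lift true u - b , b , w)

  -- For γ = `false` the third coordinate 2w is even like the first two, and 4 cancels throughout.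
  Doubled⇔OddSum : ∀ {M} v → Doubled false (+ 4 * M) v ⇔ OddSum M v
  Doubled⇔OddSum (u , b , w) = same-multiple (+ 4) (solve 3 (λ u b w →
    formₚ (+ 1) (con (+ 2) :* (liftₚ (con (+ 1)) u :- b)) (con (+ 2) :* b) (liftₚ (con (+ 0)) w) :=
    con (+ 4) :* formₚ (+ 1) (liftₚ (con (+ 1)) u :- b) b w) refl u b w)

  -- As a + b is odd, the parity β of b forces the parity `not β` of a, while that of w is free.
  OddSum-octants : ∀ {M q} (c : Bool → Bool → Bool → ℕ) → (∀ α β γ → Count (Octant α β γ M) (c α β γ)) →
                   Count (OddSum M) q → q ≡ Σ₂ λ β → Σ₂ (c (not β) β)
  OddSum-octants {M} c octant count =
    let d , q≡ , pieces = bisect² (λ (b , w , u) → OddSum M (u , b , w)) (rotate (OddSum M) count)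
    in trans q≡ (Σ₂-cong λ β → Σ₂-cong λ γ →
         count-unique (λ _ → mk⇔ id id) (piece β γ (pieces β γ)) (octant (not β) β γ))
    where
    -- The expression `+ 1 - bit β` is a polynomial in the bit, so a single solver identity covers
    -- both parities.
    bit-not : ∀ β → bit (not β) ≡ + 1 - bit β
    bit-not false = refl
    bit-not true  = refl

    piece : ∀ β γ {n} → Count (λ ((b , w , u) : Triple) → OddSum M (u , lift β b , lift γ w)) n →
            Count (Octant (not β) β γ M) n
    piece β γ = transport {P = λ (b , w , u) → OddSum M (u , lift β b , lift γ w)}
      (λ (x , y , z) → y , z , x + y) (λ (b , w , u) → u - b , b , w)
      (λ (b , w , u) → triple-≡ refl refl (x-y+y≡x u b))
      (λ (x , y , z) → triple-≡ (x+y-y≡x x y) refl refl)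
      (λ (x , y , z) → same-value (trans
        (solve 5 (λ b c x y z →
          formₚ (+ 1) (liftₚ (con (+ 1)) (x :+ y) :- liftₚ b y) (liftₚ b y) (liftₚ c z) :=
          formₚ (+ 1) (liftₚ (con (+ 1) :- b) x) (liftₚ b y) (liftₚ c z)) refl (bit β) (bit γ) x y z)
        (cong (λ a → ⟨1,3,3⟩ (+ 2 * x + a , lift β y , lift γ z)) (sym (bit-not β)))))

  -- Congruences modulo 8

  pronic-even : ∀ x → ∃ λ j → x * x + x ≡ + 2 * j
  pronic-even x with parity x
  ... | false , k , refl = _ , solve 1 (λ k → liftₚ (con (+ 0)) k :* liftₚ (con (+ 0)) k :+ liftₚ (con (+ 0)) k
                             := con (+ 2) :* (con (+ 2) :* (k :* k) :+ k)) refl k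
  ... | true  , k , refl = _ , solve 1 (λ k → liftₚ (con (+ 1)) k :* liftₚ (con (+ 1)) k :+ liftₚ (con (+ 1)) k
                             := con (+ 2) :* (con (+ 2) :* (k :* k) :+ con (+ 3) :* k :+ con (+ 1))) refl k

  odd-square : ∀ x → ∃ λ j → lift true x * lift true x ≡ + 8 * j + + 1
  odd-square x with pronic-even x
  ... | j , e = j , trans
    (solve 1 (λ x → liftₚ (con (+ 1)) x :* liftₚ (con (+ 1)) x := con (+ 4) :* (x :* x :+ x) :+ con (+ 1)) refl x)
    (trans (cong (λ w → + 4 * w + + 1) e)
           (solve 1 (λ j → con (+ 4) :* (con (+ 2) :* j) :+ con (+ 1) := con (+ 8) :* j :+ con (+ 1)) refl j))

  -- Odd squares are 1 modulo 8, so in the all-odd octant the form is 1 + 3 + 3 = 7 modulo 8.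
  odd-octant-empty : ∀ {n} k → Count (Octant true true true (+ 8 * k + + 3)) n → n ≡ 0
  odd-octant-empty k = count-empty λ (x , y , z) e → clash x y z e
    where
    clash : ∀ x y z → ¬ Octant true true true (+ 8 * k + + 3) (x , y , z)
    clash x y z e with odd-square x | odd-square y | odd-square z
    ... | i , ei | j , ej | l , el = residues-clash (+ 8) (+ 7) (+ 3) (i + + 3 * j + + 3 * l) k (begin
      + 1 * (lift true x * lift true x) + + 3 * (lift true y * lift true y) + + 3 * (lift true z * lift true z)
        ≡⟨ cong₂ _+_ (cong₂ _+_ (cong (+ 1 *_) ei) (cong (+ 3 *_) ej)) (cong (+ 3 *_) el) ⟩
      + 1 * (+ 8 * i + + 1) + + 3 * (+ 8 * j + + 1) + + 3 * (+ 8 * l + + 1)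
        ≡⟨ solve 3 (λ i j l → con (+ 1) :* (con (+ 8) :* i :+ con (+ 1)) :+ con (+ 3) :* (con (+ 8) :* j :+ con (+ 1))
                   :+ con (+ 3) :* (con (+ 8) :* l :+ con (+ 1)) :=
                   con (+ 8) :* (i :+ con (+ 3) :* j :+ con (+ 3) :* l) :+ con (+ 7)) refl i j l ⟩
      + 8 * (i + + 3 * j + + 3 * l) + + 7 ∎) e
      where open ≡-Reasoning

  -- Modulo 8, 4(x² + 3y²) + 3 ≡ 7 forces x + y to be odd.
  Doubled-octant : ∀ {d e} k → Count (Doubled true (+ 8 * k + + 7)) d →
                   Count (Octant false false true (+ 8 * k + + 7)) e → e ≡ d
  Doubled-octant {d} {e} k countD countO
    with bisect (λ (m , y , z) → Octant false false true (+ 8 * k + + 7) (m - y , y , z))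
      (transport {P = Octant false false true (+ 8 * k + + 7)}
        (λ (m , y , z) → m - y , y , z) (λ (x , y , z) → x + y , y , z)
        (λ (x , y , z) → triple-≡ (x+y-y≡x x y) refl refl)
        (λ (m , y , z) → triple-≡ (x-y+y≡x m y) refl refl)
        (λ _ → mk⇔ id id) countO)
  ... | c , e≡ , pieces = trans e≡ (cong₂ ℕ._+_ (count-empty even (pieces false))
                                                (count-unique odd (pieces true) countD))
    where
    M : ℤ
    M = + 8 * k + + 7

    Piece : Bool → Triple → Set
    Piece α (m , y , z) = Octant false false true M (lift α m - y , y , z)

    even : ∀ v → ¬ Piece false v
    even (m , y , z) e with odd-square z
    -- For x = 2m - y one has 4(x² + 3y²) = 16(m² - my + y²), so only three times an odd square
    -- remains modulo 8, which is 3.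
    ... | j , ej = residues-clash (+ 8) (+ 3) (+ 7) (+ 2 * (m * m - m * y + y * y) + + 3 * j) k (begin
      form (+ 1) (+ 3) (+ 3) x (lift false y) (lift true z)
        ≡⟨ cong (λ w → + 1 * (x * x) + + 3 * (lift false y * lift false y) + + 3 * w) ej ⟩
      + 1 * (x * x) + + 3 * (lift false y * lift false y) + + 3 * (+ 8 * j + + 1)
        ≡⟨ solve 3 (λ m y j → let x = liftₚ (con (+ 0)) (liftₚ (con (+ 0)) m :- y) in
             con (+ 1) :* (x :* x) :+ con (+ 3) :* (liftₚ (con (+ 0)) y :* liftₚ (con (+ 0)) y)
               :+ con (+ 3) :* (con (+ 8) :* j :+ con (+ 1)) :=
             con (+ 8) :* (con (+ 2) :* (m :* m :- m :* y :+ y :* y) :+ con (+ 3) :* j) :+ con (+ 3)) refl m y j ⟩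
      + 8 * (+ 2 * (m * m - m * y + y * y) + + 3 * j) + + 3 ∎) e
      where
      open ≡-Reasoning
      x = lift false (lift false m - y)

    odd : ∀ v → Piece true v ⇔ Doubled true M v
    odd (m , y , z) = same-value (solve 3 (λ m y z →
      formₚ (+ 1) (liftₚ (con (+ 0)) (liftₚ (con (+ 1)) m :- y)) (liftₚ (con (+ 0)) y) (liftₚ (con (+ 1)) z) :=
      formₚ (+ 1) (con (+ 2) :* (liftₚ (con (+ 1)) m :- y)) (con (+ 2) :* y) (liftₚ (con (+ 1)) z)) refl m y z)

  even-octant : ∀ {M} v → Octant false false false (+ 4 * M) v ⇔ Rep ⟨1,3,3⟩ M v
  even-octant (x , y , z) = same-multiple (+ 4) (solve 3 (λ x y z →
    formₚ (+ 1) (liftₚ (con (+ 0)) x) (liftₚ (con (+ 0)) y) (liftₚ (con (+ 0)) z) :=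
    con (+ 4) :* formₚ (+ 1) x y z) refl x y z)

  -- The enumeration box and the counts N and t

  symRange-unique : ∀ k → Unique (symRange k)
  symRange-unique k = Unique.map⁺ (λ {i} {j} e → ℤ.+-injective
    (trans (sym (x-y+y≡x (+ i) (+ k))) (trans (cong (_+ + k) e) (x-y+y≡x (+ j) (+ k))))) (Unique.upTo⁺ _)

  ∈-symRange : ∀ {k} x → ∣ x ∣ ℕ.≤ k → x ∈ symRange k
  ∈-symRange {k} (+ n) n≤k = subst (_∈ symRange k) (x+y-y≡x (+ n) (+ k))
    (∈-map⁺ (λ i → + i - + k) (∈-upTo⁺ (s≤s (ℕ.+-monoˡ-≤ k n≤k))))
  ∈-symRange -[1+ n ] n<k with ℕ.m≤n⇒∃[o]m+o≡n n<k
  -- For x = -(n + 1) and k = (n + 1) + j the entry with index j is j - k = x.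
  ... | j , refl = subst (_∈ symRange (suc n ℕ.+ j)) (solve 2 (λ s j → j :- (s :+ j) := :- s) refl (+ suc n) (+ j))
    (∈-map⁺ (λ i → + i - + (suc n ℕ.+ j)) (∈-upTo⁺ (s≤s (ℕ.≤-trans (ℕ.m≤n+m j (suc n)) (ℕ.m≤m+n _ _)))))

  -- `column` and `plane` name the inner loops of `box`; the y-coordinate tells columns apart, the
  -- x-coordinate planes.
  column : ℕ → ℤ → ℤ → List Triple
  column k x y = map (λ z → x , y , z) (symRange k)

  plane : ℕ → ℤ → List Triple
  plane k x = concatMap (column k x) (symRange k)

  box-unique : ∀ k → Unique (box k)
  box-unique k = concatMap-unique (plane k)
    (λ x → concatMap-unique (column k x)
      (λ y → Unique.map⁺ (cong (proj₂ ∘ proj₂)) (symRange-unique k))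
      (λ v∈ v∈′ → trans (sym (second v∈)) (second v∈′))
      (symRange-unique k))
    (λ v∈ v∈′ → trans (sym (first v∈)) (first v∈′))
    (symRange-unique k)
    where
    second : ∀ {x y v} → v ∈ column k x y → proj₁ (proj₂ v) ≡ y
    second {x} {y} v∈ with ∈-map⁻ (λ z → x , y , z) v∈
    ... | _ , _ , refl = refl

    first : ∀ {x v} → v ∈ plane k x → proj₁ v ≡ x
    first {x} v∈ with ∈-concat⁻′ (map (column k x) (symRange k)) v∈
    ... | _ , v∈ys , ys∈ with ∈-map⁻ (column k x) ys∈
    ... | y , _ , refl with ∈-map⁻ (λ z → x , y , z) v∈ys
    ... | _ , _ , refl = refl

  ∈-box : ∀ {k} x y z → ∣ x ∣ ℕ.≤ k → ∣ y ∣ ℕ.≤ k → ∣ z ∣ ℕ.≤ k → (x , y , z) ∈ box k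
  ∈-box {k} x y z x≤ y≤ z≤ =
    ∈-concat⁺′ (∈-concat⁺′ (∈-map⁺ (λ z → x , y , z) (∈-symRange z z≤))
                           (∈-map⁺ (column k x) (∈-symRange y y≤)))
      (∈-map⁺ (plane k) (∈-symRange x x≤))

  +∣i∣≡i : ∀ {i n} → i ≡ + n → + ∣ i ∣ ≡ i
  +∣i∣≡i refl = refl

  +sq≡ : ∀ x → + sq x ≡ x * x
  +sq≡ x = +∣i∣≡i (square x)
    where
    square : ∀ x → x * x ≡ + (∣ x ∣ ℕ.* ∣ x ∣)
    square (+ _)    = ℤ.+◃n≡+n _
    square -[1+ _ ] = ℤ.+◃n≡+n _

  -- `tri` halves an absolute value in ℕ. The rounding is harmless because x(x + 1) is even, the
  -- absolute value because x(x + 1) is nonnegative for every integer x.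
  2*+tri≡ : ∀ x → + 2 * + tri x ≡ x * (x + + 1)
  2*+tri≡ x with pronic-even x
  ... | j , e = begin
    + 2 * + tri x               ≡⟨ cong (λ w → + 2 * + (∣ w ∣ ℕ./ 2)) p≡ ⟩
    + 2 * + (∣ + 2 * j ∣ ℕ./ 2) ≡⟨ cong (λ w → + 2 * + (w ℕ./ 2)) (trans (ℤ.abs-* (+ 2) j) (ℕ.*-comm 2 ∣ j ∣)) ⟩
    + 2 * + (∣ j ∣ ℕ.* 2 ℕ./ 2) ≡⟨ cong (λ w → + 2 * + w) (ℕ.m*n/n≡m ∣ j ∣ 2) ⟩
    + 2 * + ∣ j ∣               ≡⟨ ℤ.pos-* 2 ∣ j ∣ ⟨
    + (2 ℕ.* ∣ j ∣)             ≡⟨ cong +_ (ℤ.abs-* (+ 2) j) ⟨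
    + ∣ + 2 * j ∣               ≡⟨ cong (λ w → + ∣ w ∣) p≡ ⟨
    + ∣ x * (x + + 1) ∣         ≡⟨ +∣i∣≡i (proj₂ (natural x)) ⟩
    x * (x + + 1)               ∎
    where
    open ≡-Reasoning
    p≡ : x * (x + + 1) ≡ + 2 * j
    p≡ = trans (solve 1 (λ x → x :* (x :+ con (+ 1)) := x :* x :+ x) refl x) e

    natural : ∀ x → ∃ λ n → x * (x + + 1) ≡ + n
    natural (+ _)        = _ , ℤ.+◃n≡+n _
    natural -[1+ zero ]  = 0 , refl
    natural -[1+ suc _ ] = _ , refl

  odd-square-tri : ∀ x → lift true x * lift true x ≡ + 8 * + tri x + + 1
  odd-square-tri x = trans
    (solve 1 (λ x → liftₚ (con (+ 1)) x :* liftₚ (con (+ 1)) x := con (+ 4) :* (x :* (x :+ con (+ 1))) :+ con (+ 1)) refl x)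
    (trans (cong (λ w → + 4 * w + + 1) (sym (2*+tri≡ x)))
           (solve 1 (λ j → con (+ 4) :* (con (+ 2) :* j) :+ con (+ 1) := con (+ 8) :* j :+ con (+ 1)) refl (+ tri x)))

  ∣x∣≤sq : ∀ x → ∣ x ∣ ℕ.≤ sq x
  ∣x∣≤sq x = subst (∣ x ∣ ℕ.≤_) (sym (ℤ.abs-* x x)) (m≤m*m ∣ x ∣)
    where
    m≤m*m : ∀ m → m ℕ.≤ m ℕ.* m
    m≤m*m zero    = z≤n
    m≤m*m (suc m) = ℕ.m≤m*n (suc m) (suc m)

  2*tri≡ : ∀ x → 2 ℕ.* tri x ≡ ∣ x ∣ ℕ.* ∣ x + + 1 ∣
  2*tri≡ x = trans (sym (ℤ.abs-* (+ 2) (+ tri x))) (trans (cong ∣_∣ (2*+tri≡ x)) (ℤ.abs-* x (x + + 1)))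

  -- Equality holds at x = -1 and x = -2; hence the radius `suc n` of the box in the definition of
  -- `t`.
  ∣x∣≤1+tri : ∀ x → ∣ x ∣ ℕ.≤ suc (tri x)
  ∣x∣≤1+tri (+ zero)     = z≤n
  ∣x∣≤1+tri (+ suc m)    = ℕ.m≤n⇒m≤1+n (ℕ.*-cancelˡ-≤ 2 (begin
    2 ℕ.* suc m             ≡⟨ ℕ.*-comm 2 (suc m) ⟩
    suc m ℕ.* 2             ≤⟨ ℕ.*-monoʳ-≤ (suc m) (s≤s (ℕ.m≤n+m 1 m)) ⟩
    suc m ℕ.* (suc m ℕ.+ 1) ≡⟨ 2*tri≡ (+ suc m) ⟨
    2 ℕ.* tri (+ suc m)     ∎))
    where open ℕ.≤-Reasoning
  ∣x∣≤1+tri -[1+ zero ]  = s≤s z≤n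
  ∣x∣≤1+tri -[1+ suc m ] = s≤s (ℕ.*-cancelˡ-≤ 2 (begin
    2 ℕ.* suc m             ≤⟨ ℕ.*-monoˡ-≤ (suc m) {2} {suc (suc m)} (s≤s (s≤s z≤n)) ⟩
    suc (suc m) ℕ.* suc m   ≡⟨ 2*tri≡ -[1+ suc m ] ⟨
    2 ℕ.* tri -[1+ suc m ]  ∎))
    where open ℕ.≤-Reasoning

  weighted-bound : ∀ a b c {p q r n} .{{_ : ℕ.NonZero a}} .{{_ : ℕ.NonZero b}} .{{_ : ℕ.NonZero c}} →
                   a ℕ.* p ℕ.+ b ℕ.* q ℕ.+ c ℕ.* r ≡ n → p ℕ.≤ n × q ℕ.≤ n × r ℕ.≤ n
  weighted-bound a b c {p} {q} {r} refl =
    ℕ.≤-trans (ℕ.m≤n*m p a) (ℕ.≤-trans (ℕ.m≤m+n _ _) (ℕ.m≤m+n _ _)) ,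
    ℕ.≤-trans (ℕ.m≤n*m q b) (ℕ.≤-trans (ℕ.m≤n+m _ (a ℕ.* p)) (ℕ.m≤m+n _ _)) ,
    ℕ.≤-trans (ℕ.m≤n*m r c) (ℕ.m≤n+m _ (a ℕ.* p ℕ.+ b ℕ.* q))

  module _ (a b c : ℕ) where

    +form : ∀ p q r → + (a ℕ.* p ℕ.+ b ℕ.* q ℕ.+ c ℕ.* r) ≡ + a * + p + + b * + q + + c * + r
    +form p q r = cong₂ _+_ (cong₂ _+_ (ℤ.pos-* a p) (ℤ.pos-* b q)) (ℤ.pos-* c r)

    module _ .{{_ : ℕ.NonZero a}} .{{_ : ℕ.NonZero b}} .{{_ : ℕ.NonZero c}} where

      -- As ∣x∣ ≤ x² ≤ n for positive coefficients, and likewise for y and z, the box holds every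
      -- solution.
      N-counts : ∀ n → Count (Rep (λ (x , y , z) → form (+ a) (+ b) (+ c) x y z) (+ n)) (N a b c n)
      N-counts n = count-cong
        (λ (x , y , z) →
          let form≡ = trans (+form (sq x) (sq y) (sq z))
                        (cong₂ _+_ (cong₂ _+_ (cong (+ a *_) (+sq≡ x)) (cong (+ b *_) (+sq≡ y))) (cong (+ c *_) (+sq≡ z)))
          in mk⇔ (λ e → trans (sym form≡) (cong +_ e)) (λ e → ℤ.+-injective (trans form≡ e)))
        (count-filter (λ (x , y , z) → a ℕ.* sq x ℕ.+ b ℕ.* sq y ℕ.+ c ℕ.* sq z ℕ.≟ n) (box-unique n) λ {(x , y , z)} e →
          let x≤ , y≤ , z≤ = weighted-bound a b c e
          in ∈-box x y z (ℕ.≤-trans (∣x∣≤sq x) x≤) (ℕ.≤-trans (∣x∣≤sq y) y≤) (ℕ.≤-trans (∣x∣≤sq z) z≤))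

      -- Multiplying by 8 and adding a + b + c completes the squares: 8T + 1 = (2x + 1)² for T = x(x
      -- + 1)/2.
      t-counts : ∀ n → Count (Rep (λ (x , y , z) → form (+ a) (+ b) (+ c) (lift true x) (lift true y) (lift true z))
                                  (+ 8 * + n + (+ a + + b + + c))) (t a b c n)
      t-counts n = count-cong
        (λ (x , y , z) →
          let form≡ = trans
                (cong₂ _+_ (cong₂ _+_ (cong (+ a *_) (odd-square-tri x)) (cong (+ b *_) (odd-square-tri y)))
                           (cong (+ c *_) (odd-square-tri z)))
                (trans (solve 6 (λ a b c x y z →
                    a :* (con (+ 8) :* x :+ con (+ 1)) :+ b :* (con (+ 8) :* y :+ con (+ 1)) :+ c :* (con (+ 8) :* z :+ con (+ 1)) :=
                    con (+ 8) :* (a :* x :+ b :* y :+ c :* z) :+ (a :+ b :+ c))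
                    refl (+ a) (+ b) (+ c) (+ tri x) (+ tri y) (+ tri z))
                  (cong (λ w → + 8 * w + (+ a + + b + + c)) (sym (+form (tri x) (tri y) (tri z)))))
          in mk⇔ (λ e → trans form≡ (cong (λ m → + 8 * + m + (+ a + + b + + c)) e))
                 (λ e → ℤ.+-injective (ℤ.*-cancelˡ-≡ (+ 8) _ _
                   (cancel (trans (sym form≡) e)))))
        (count-filter (λ (x , y , z) → a ℕ.* tri x ℕ.+ b ℕ.* tri y ℕ.+ c ℕ.* tri z ℕ.≟ n) (box-unique (suc n)) λ {(x , y , z)} e →
          let x≤ , y≤ , z≤ = weighted-bound a b c e
              within = λ w {k} (w≤ : tri w ℕ.≤ k) → ℕ.≤-trans (∣x∣≤1+tri w) (s≤s w≤)
          in ∈-box x y z (within x x≤) (within y y≤) (within z z≤))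
        where
        cancel : ∀ {u v s} → u + s ≡ v + s → u ≡ v
        cancel {u} {v} {s} e = trans (sym (x+y-y≡x u s)) (trans (cong (_- s) e) (x+y-y≡x v s))

  -- Octant counts and their relations

  -- Abstract, so that conversion checks never unfold the enumeration of the box.
  abstract
    octant-counts : ∀ m → ∃ λ (c : Bool → Bool → Bool → ℕ) → N 1 3 3 m ≡ total c ×
                                  ∀ α β γ → Count (Octant α β γ (+ m)) (c α β γ)
    octant-counts m = octants (Rep ⟨1,3,3⟩ (+ m)) (N-counts 1 3 3 m)

  octant# : ℕ → Bool → Bool → Bool → ℕ
  octant# m = proj₁ (octant-counts m)

  N-octants : ∀ m → N 1 3 3 m ≡ total (octant# m)
  N-octants m = proj₁ (proj₂ (octant-counts m))

  octant#-counts : ∀ m α β γ → Count (Octant α β γ (+ m)) (octant# m α β γ)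
  octant#-counts m = proj₂ (proj₂ (octant-counts m))

  octant#-sym : ∀ m α β γ → octant# m α β γ ≡ octant# m α γ β
  octant#-sym m α β γ = octant-sym α β γ (octant#-counts m α β γ) (octant#-counts m α γ β)

  octant#-zero : ∀ m k s → m ≡ s ℕ.+ k ℕ.* 4 → ∀ α β γ
                 {_ : False (+ 4 ∣? (+ s - ⟨1,3,3⟩ (bit α , bit β , bit γ)))} → octant# m α β γ ≡ 0
  octant#-zero m k s refl α β γ {4∤} = octant-empty α β γ (+ s) {4∤} (+ k) (begin
    + s + + (k ℕ.* 4) ≡⟨ ℤ.+-comm (+ s) (+ (k ℕ.* 4)) ⟩
    + (k ℕ.* 4) + + s ≡⟨ cong (λ w → + w + + s) (ℕ.*-comm k 4) ⟩
    + (4 ℕ.* k) + + s ≡⟨ cong (_+ + s) (ℤ.pos-* 4 k) ⟩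
    + 4 * + k + + s   ∎) (octant#-counts m α β γ)
    where open ≡-Reasoning

  -- The number of (a, b, v) with a² + 3b² + 3v² = m and a + b odd, expressed through octants.
  oddSum# : ℕ → ℕ
  oddSum# m = mixed (octant# m)

  octant-4* : ∀ m α β γ → Count (Octant α β γ (+ 4 * + m)) (octant# (4 ℕ.* m) α β γ)
  octant-4* m α β γ = subst (λ M → Count (Octant α β γ M) (octant# (4 ℕ.* m) α β γ)) (ℤ.pos-* 4 m)
    (octant#-counts (4 ℕ.* m) α β γ)

  t-octant : ∀ n → t 2 3 3 n ≡ octant# (4 ℕ.* suc n) true true false ℕ.+ octant# (4 ℕ.* suc n) true true false
  t-octant n = OddRep-halves {M = + suc n}
    (subst (λ M → Count (Rep (⟨2,3,3⟩ ∘ lift³ true true true) M) (t 2 3 3 n))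
      -- The shift 2 + 3 + 3 = 8 from completing the squares makes the value 8n + 8, whence M = n +
      -- 1.
      (solve 1 (λ n → con (+ 8) :* n :+ con (+ 8) := con (+ 2) :* (con (+ 4) :* (con (+ 1) :+ n))) refl (+ n))
      (t-counts 2 3 3 n))
    (octant-4* (suc n) true true false)

  octant#-4* : ∀ m → octant# (4 ℕ.* m) true true false ≡ oddSum# m ℕ.+ oddSum# m
  octant#-4* m =
    let d , h≡ , doubled = octant-halves {+ 4 * + m} {octant# (4 ℕ.* m) true true false} false (octant-4* m true true false)
        d≡ : d ≡ oddSum# m
        d≡ = OddSum-octants {+ m} (octant# m) (octant#-counts m) (undouble {d} doubled)
    in trans h≡ (cong₂ ℕ._+_ d≡ d≡)
    where
    undouble : ∀ {d} → Count (Doubled false (+ 4 * + m)) d → Count (OddSum (+ m)) d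
    undouble = count-cong {A = Triple} {P = Doubled false (+ 4 * + m)} {Q = OddSum (+ m)} (λ v → Doubled⇔OddSum {+ m} v)

  -- One factor 2 comes from which of (Y + Z)/2 and (Y - Z)/2 is odd, the other from which of X + U
  -- and X - U is divisible by 4.
  t≡4*oddSum# : ∀ n → t 2 3 3 n ≡ 4 ℕ.* oddSum# (suc n)
  t≡4*oddSum# n = trans (t-octant n) (trans (cong₂ ℕ._+_ (octant#-4* (suc n)) (octant#-4* (suc n)))
    (q+q+[q+q]≡4*q (oddSum# (suc n))))
    where
    q+q+[q+q]≡4*q : ∀ q → q ℕ.+ q ℕ.+ (q ℕ.+ q) ≡ 4 ℕ.* q
    q+q+[q+q]≡4*q = solveℕ 1 (λ q → (q ⊕ q) ⊕ (q ⊕ q) ⊜ conℕ 4 ⊗ q) refl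

  -- The form is 1 modulo 4 only in the octant (odd, even, even).
  N≡oddSum#-1 : ∀ m k → m ≡ 1 ℕ.+ k ℕ.* 4 → N 1 3 3 m ≡ oddSum# m
  N≡oddSum#-1 m k m≡ = trans (N-octants m) (total≡mixed (octant# m)
    (zeros false false false) (zeros true false true) (zeros true true false)
    (zeros false false true) (zeros true true true))
    where zeros = octant#-zero m k 1 m≡

  -- The form is 2 modulo 4 only in the octant (even, odd, odd).
  N≡oddSum#-2 : ∀ m k → m ≡ 2 ℕ.+ k ℕ.* 4 → N 1 3 3 m ≡ oddSum# m
  N≡oddSum#-2 m k m≡ = trans (N-octants m) (total≡mixed (octant# m)
    (zeros false false false) (zeros true false true) (zeros true true false)
    (zeros false false true) (zeros true true true))
    where zeros = octant#-zero m k 2 m≡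

  oddSum#-3 : ∀ m k → m ≡ 3 ℕ.+ k ℕ.* 4 → oddSum# m ≡ octant# m false false true
  oddSum#-3 m k m≡ = mixed≡ (octant# m)
    (zeros false false false) (zeros true false true) (zeros true true false)
    (zeros true false false) (zeros false true true) (octant#-sym m false true false)
    where zeros = octant#-zero m k 3 m≡

  N≡2*oddSum#-3 : ∀ m k → m ≡ 3 ℕ.+ k ℕ.* 4 → N 1 3 3 m ≡ oddSum# m ℕ.+ oddSum# m ℕ.+ octant# m true true true
  N≡2*oddSum#-3 m k m≡ = trans (N-octants m) (total≡2*mixed (octant# m)
    (zeros false false false) (zeros true false true) (zeros true true false)
    (zeros true false false) (zeros false true true) (octant#-sym m false true false))
    where zeros = octant#-zero m k 3 m≡

  module _ (n : ℕ) where
    private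
      m = 4 ℕ.* suc n
      zeros = octant#-zero m (suc n) 0 (ℕ.*-comm 4 (suc n))
      sym10 = octant#-sym m true false true

    -- At the value 4(n + 1) the all-even octant rescales to N(1,3,3;n+1), while (odd, odd, even)
    -- and its mirror image add up to t(2,3,3;n).
    N-4* : N 1 3 3 m ≡ N 1 3 3 (suc n) ℕ.+ t 2 3 3 n
    N-4* = trans (N-octants m) (trans
      (total-0 (octant# m) (zeros false false true) (zeros false true false) (zeros false true true)
        (zeros true false false) (zeros true true true) sym10)
      (cong₂ ℕ._+_ (count-unique (even-octant {+ suc n}) (octant-4* (suc n) false false false) (N-counts 1 3 3 (suc n)))
                   (sym (t-octant n))))

    oddSum#-4* : oddSum# m ≡ octant# m true true false
    oddSum#-4* = mixed-0 (octant# m) (zeros true false false) (zeros false true false) (zeros false true true) sym10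

    -- Let h count the octant (odd, odd, even) at 4(n + 1). Then t(2,3,3;n) = 2h, and h is also the
    -- value of `oddSum#` at 4(n + 1), so the left side is 4h.
    t-4* : t 2 3 3 (3 ℕ.+ 4 ℕ.* n) ≡ 2 ℕ.* t 2 3 3 n
    t-4* = begin
      t 2 3 3 (3 ℕ.+ 4 ℕ.* n)       ≡⟨ t≡4*oddSum# (3 ℕ.+ 4 ℕ.* n) ⟩
      4 ℕ.* oddSum# (4 ℕ.+ 4 ℕ.* n) ≡⟨ cong (λ w → 4 ℕ.* oddSum# w) (ℕ.*-suc 4 n) ⟨
      4 ℕ.* oddSum# m               ≡⟨ cong (4 ℕ.*_) oddSum#-4* ⟩
      4 ℕ.* h                       ≡⟨ ℕ.*-assoc 2 2 h ⟩
      2 ℕ.* (2 ℕ.* h)               ≡⟨ cong (λ w → 2 ℕ.* (h ℕ.+ w)) (ℕ.+-identityʳ h) ⟩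
      2 ℕ.* (h ℕ.+ h)               ≡⟨ cong (2 ℕ.*_) (t-octant n) ⟨
      2 ℕ.* t 2 3 3 n               ∎
      where
      open ≡-Reasoning
      h = octant# m true true false

  pos-r+k*8 : ∀ r k → + (r ℕ.+ k ℕ.* 8) ≡ + 8 * + k + + r
  pos-r+k*8 r k = trans (ℤ.+-comm (+ r) (+ (k ℕ.* 8)))
    (cong (_+ + r) (trans (cong +_ (ℕ.*-comm k 8)) (ℤ.pos-* 8 k)))

  octant-8* : ∀ r k α β γ → Count (Octant α β γ (+ 8 * + k + + r)) (octant# (r ℕ.+ k ℕ.* 8) α β γ)
  octant-8* r k α β γ = subst (λ M → Count (Octant α β γ M) (octant# (r ℕ.+ k ℕ.* 8) α β γ)) (pos-r+k*8 r k)
    (octant#-counts (r ℕ.+ k ℕ.* 8) α β γ)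

  odd-octant-3 : ∀ k → octant# (3 ℕ.+ k ℕ.* 8) true true true ≡ 0
  odd-octant-3 k = odd-octant-empty (+ k) (octant-8* 3 k true true true)

  -- Multiplication by 1 + √-3 makes the all-odd octant twice `Doubled true`, which for values 7
  -- modulo 8 is the octant (even, even, odd) in other coordinates.
  odd-octant-7 : ∀ k → octant# (7 ℕ.+ k ℕ.* 8) true true true ≡ 2 ℕ.* octant# (7 ℕ.+ k ℕ.* 8) false false true
  odd-octant-7 k =
    let M = + 8 * + k + + 7
        d , h≡ , doubled = octant-halves {M} {octant# (7 ℕ.+ k ℕ.* 8) true true true} true (octant-8* 7 k true true true)
        e≡d = Doubled-octant (+ k) doubled (octant-8* 7 k false false true)
    in trans h≡ (cong₂ ℕ._+_ (sym e≡d) (trans (sym e≡d) (sym (ℕ.+-identityʳ _))))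

  -- Completing the squares shifts by 1 + 3 + 3 = 7.
  t-1-3-3 : ∀ k → t 1 3 3 k ≡ octant# (7 ℕ.+ k ℕ.* 8) true true true
  t-1-3-3 k = count-unique (λ _ → mk⇔ id id) (t-counts 1 3 3 k) (octant-8* 7 k true true true)

-- The residue classes of n

open Integral
open import Data.Nat using (_+_; _*_; _%_; _/_)

odd-octant≡2*oddSum# : ∀ k → octant# (7 + k * 8) true true true ≡ 2 * oddSum# (7 + k * 8)
odd-octant≡2*oddSum# k = trans (odd-octant-7 k) (cong (2 *_) (sym (oddSum#-3 (7 + k * 8) (1 + k * 2)
  (solveℕ 1 (λ k → conℕ 7 ⊕ k ⊗ conℕ 8 ⊜ conℕ 3 ⊕ (conℕ 1 ⊕ k ⊗ conℕ 2) ⊗ conℕ 4) refl k))))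

t-0mod4 : ∀ k → t 2 3 3 (k * 4) ≡ 4 * N 1 3 3 (suc (k * 4))
t-0mod4 k = trans (t≡4*oddSum# (k * 4)) (cong (4 *_) (sym (N≡oddSum#-1 (suc (k * 4)) k refl)))

t-1mod4 : ∀ k → t 2 3 3 (1 + k * 4) ≡ 4 * N 1 3 3 (2 + k * 4)
t-1mod4 k = trans (t≡4*oddSum# (1 + k * 4)) (cong (4 *_) (sym (N≡oddSum#-2 (2 + k * 4) k refl)))

-- The all-odd octant is empty at 3 modulo 8, so N = 2q while t = 4q.
t-2mod8 : ∀ k → t 2 3 3 (2 + k * 8) ≡ 2 * N 1 3 3 (3 + k * 8)
t-2mod8 k = begin
  t 2 3 3 (2 + k * 8) ≡⟨ t≡4*oddSum# (2 + k * 8) ⟩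
  4 * q               ≡⟨ solveℕ 1 (λ q → conℕ 4 ⊗ q ⊜ conℕ 2 ⊗ (q ⊕ q ⊕ conℕ 0)) refl q ⟩
  2 * (q + q + 0)     ≡⟨ cong (λ w → 2 * (q + q + w)) (odd-octant-3 k) ⟨
  2 * (q + q + octant# m true true true)
    ≡⟨ cong (2 *_) (N≡2*oddSum#-3 m (k * 2)
         (solveℕ 1 (λ k → conℕ 3 ⊕ k ⊗ conℕ 8 ⊜ conℕ 3 ⊕ (k ⊗ conℕ 2) ⊗ conℕ 4) refl k)) ⟨
  2 * N 1 3 3 m                   ∎
  where
  open ≡-Reasoning
  m = 3 + k * 8
  q = oddSum# m

-- At 7 modulo 8 the all-odd octant contributes 2q, so N = 2q + 2q agrees with t = 4q.
t-6mod8 : ∀ k → t 2 3 3 (6 + k * 8) ≡ N 1 3 3 (7 + k * 8)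
t-6mod8 k = begin
  t 2 3 3 (6 + k * 8) ≡⟨ t≡4*oddSum# (6 + k * 8) ⟩
  4 * q               ≡⟨ solveℕ 1 (λ q → conℕ 4 ⊗ q ⊜ q ⊕ q ⊕ conℕ 2 ⊗ q) refl q ⟩
  q + q + 2 * q       ≡⟨ cong (λ w → q + q + w) (odd-octant≡2*oddSum# k) ⟨
  q + q + octant# m true true true
    ≡⟨ N≡2*oddSum#-3 m (1 + k * 2)
         (solveℕ 1 (λ k → conℕ 7 ⊕ k ⊗ conℕ 8 ⊜ conℕ 3 ⊕ (conℕ 1 ⊕ k ⊗ conℕ 2) ⊗ conℕ 4) refl k) ⟨
  N 1 3 3 m                         ∎
  where
  open ≡-Reasoning
  m = 7 + k * 8
  q = oddSum# m

t-6mod8-133 : ∀ k → t 2 3 3 (6 + k * 8) ≡ 2 * t 1 3 3 k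
t-6mod8-133 k = begin
  t 2 3 3 (6 + k * 8) ≡⟨ t≡4*oddSum# (6 + k * 8) ⟩
  4 * q               ≡⟨ ℕ.*-assoc 2 2 q ⟩
  2 * (2 * q)         ≡⟨ cong (2 *_) (trans (t-1-3-3 k) (odd-octant≡2*oddSum# k)) ⟨
  2 * t 1 3 3 k       ∎
  where
  open ≡-Reasoning
  q = oddSum# (7 + k * 8)

module _ (n₀ a b : ℕ) (t≡ : a * t 2 3 3 n₀ ≡ b * N 1 3 3 (suc n₀)) where

  -- Passing from n₀ to 4n₀ + 3 changes τ to 2τ and r to r + τ, so the proportion aτ = br becomes (a
  -- + b)(2τ) = 2b(r + τ). The ratios 4, 2 and 1 thereby turn into 8/5, 4/3 and 1.
  ratio-4* : ∀ n → n ≡ 3 + 4 * n₀ → (a + b) * t 2 3 3 n ≡ 2 * b * N 1 3 3 (suc n)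
  ratio-4* n refl = begin
    (a + b) * t 2 3 3 n          ≡⟨ cong ((a + b) *_) (t-4* n₀) ⟩
    (a + b) * (2 * τ)            ≡⟨ solveℕ 3 (λ a b τ → (a ⊕ b) ⊗ (conℕ 2 ⊗ τ) ⊜ conℕ 2 ⊗ (a ⊗ τ ⊕ b ⊗ τ)) refl a b τ ⟩
    2 * (a * τ + b * τ)          ≡⟨ cong (λ w → 2 * (w + b * τ)) t≡ ⟩
    2 * (b * r + b * τ)          ≡⟨ solveℕ 3 (λ b r τ → conℕ 2 ⊗ (b ⊗ r ⊕ b ⊗ τ) ⊜ conℕ 2 ⊗ b ⊗ (r ⊕ τ)) refl b r τ ⟩
    2 * b * (r + τ)              ≡⟨ cong (2 * b *_) (N-4* n₀) ⟨
    2 * b * N 1 3 3 (4 * suc n₀) ≡⟨ cong (λ w → 2 * b * N 1 3 3 w) (ℕ.*-suc 4 n₀) ⟩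
    2 * b * N 1 3 3 (suc n)      ∎
    where
    open ≡-Reasoning
    τ = t 2 3 3 n₀
    r = N 1 3 3 (suc n₀)

residue : ∀ n d .{{_ : NonZero d}} {r} → n % d ≡ r → n ≡ r + n / d * d
residue n d refl = ℕ.m≡m%n+[m/n]*n n d

module _ (n : ℕ) where

  case-0-1 : n % 4 ≡ 0 ⊎ n % 4 ≡ 1 → t 2 3 3 n ≡ 4 * N 1 3 3 (suc n)
  case-0-1 (inj₁ e) = subst (λ n → t 2 3 3 n ≡ 4 * N 1 3 3 (suc n)) (sym (residue n 4 e)) (t-0mod4 (n / 4))
  case-0-1 (inj₂ e) = subst (λ n → t 2 3 3 n ≡ 4 * N 1 3 3 (suc n)) (sym (residue n 4 e)) (t-1mod4 (n / 4))

  case-2 : n % 8 ≡ 2 → t 2 3 3 n ≡ 2 * N 1 3 3 (suc n)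
  case-2 e = subst (λ n → t 2 3 3 n ≡ 2 * N 1 3 3 (suc n)) (sym (residue n 8 e)) (t-2mod8 (n / 8))

  case-6-27 : n % 8 ≡ 6 ⊎ n % 32 ≡ 27 → t 2 3 3 n ≡ N 1 3 3 (suc n)
  case-6-27 (inj₁ e) = subst (λ n → t 2 3 3 n ≡ N 1 3 3 (suc n)) (sym (residue n 8 e)) (t-6mod8 (n / 8))
  -- The ratio 1 : 1 comes back as 2 : 2, and 27 + 32k = 3 + 4(6 + 8k).
  case-6-27 (inj₂ e) = ℕ.*-cancelˡ-≡ _ _ 2
    (ratio-4* (6 + n / 32 * 8) 1 1 (cong (1 *_) (t-6mod8 (n / 32))) n
      (trans (residue n 32 e)
        (solveℕ 1 (λ k → conℕ 27 ⊕ k ⊗ conℕ 32 ⊜ conℕ 3 ⊕ conℕ 4 ⊗ (conℕ 6 ⊕ k ⊗ conℕ 8)) refl (n / 32))))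

  case-3-7 : n % 16 ≡ 3 ⊎ n % 16 ≡ 7 → 5 * t 2 3 3 n ≡ 8 * N 1 3 3 (suc n)
  -- The classes 3 and 7 modulo 16 are 3 + 4n₀ with n₀ ≡ 0 and n₀ ≡ 1 (mod 4), where the ratio is 4.
  case-3-7 (inj₁ e) = ratio-4* (n / 16 * 4) 1 4 (trans (ℕ.*-identityˡ _) (t-0mod4 (n / 16))) n
    (trans (residue n 16 e)
      (solveℕ 1 (λ k → conℕ 3 ⊕ k ⊗ conℕ 16 ⊜ conℕ 3 ⊕ conℕ 4 ⊗ (k ⊗ conℕ 4)) refl (n / 16)))
  case-3-7 (inj₂ e) = ratio-4* (1 + n / 16 * 4) 1 4 (trans (ℕ.*-identityˡ _) (t-1mod4 (n / 16))) n
    (trans (residue n 16 e)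
      (solveℕ 1 (λ k → conℕ 7 ⊕ k ⊗ conℕ 16 ⊜ conℕ 3 ⊕ conℕ 4 ⊗ (conℕ 1 ⊕ k ⊗ conℕ 4)) refl (n / 16)))

  case-11 : n % 32 ≡ 11 → 3 * t 2 3 3 n ≡ 4 * N 1 3 3 (suc n)
  case-11 e = ratio-4* (2 + n / 32 * 8) 1 2 (trans (ℕ.*-identityˡ _) (t-2mod8 (n / 32))) n
    (trans (residue n 32 e)
        (solveℕ 1 (λ k → conℕ 11 ⊕ k ⊗ conℕ 32 ⊜ conℕ 3 ⊕ conℕ 4 ⊗ (conℕ 2 ⊕ k ⊗ conℕ 8)) refl (n / 32)))

t-8m+6 : ∀ m → t 2 3 3 (8 * m + 6) ≡ 2 * t 1 3 3 m
t-8m+6 m = trans (cong (t 2 3 3) (solveℕ 1 (λ m → conℕ 8 ⊗ m ⊕ conℕ 6 ⊜ conℕ 6 ⊕ m ⊗ conℕ 8) refl m)) (t-6mod8-133 m)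

t-32m+27 : ∀ m → t 2 3 3 (32 * m + 27) ≡ 4 * t 1 3 3 m
t-32m+27 m = begin
  t 2 3 3 (32 * m + 27)
    ≡⟨ cong (t 2 3 3) (solveℕ 1 (λ m → conℕ 32 ⊗ m ⊕ conℕ 27 ⊜ conℕ 3 ⊕ conℕ 4 ⊗ (conℕ 6 ⊕ m ⊗ conℕ 8)) refl m) ⟩
  t 2 3 3 (3 + 4 * (6 + m * 8)) ≡⟨ t-4* (6 + m * 8) ⟩
  2 * t 2 3 3 (6 + m * 8)       ≡⟨ cong (2 *_) (t-6mod8-133 m) ⟩
  2 * (2 * t 1 3 3 m)           ≡⟨ ℕ.*-assoc 2 2 (t 1 3 3 m) ⟨
  4 * t 1 3 3 m                 ∎
  where open ≡-Reasoning

N-2-3-3-even : ∀ m → N 2 3 3 (2 * m) ≡ N 1 3 3 m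
N-2-3-3-even m = ⟨2,3,3⟩-even {+ m}
  (subst (λ M → Count (Rep ⟨2,3,3⟩ M) (N 2 3 3 (2 * m))) (ℤ.pos-* 2 m) (N-counts 2 3 3 (2 * m)))
  (N-counts 1 3 3 m)

theorem2p1 : ((m : ℕ) →
    (N 2 3 3 (2 * m) ≡ N 1 3 3 m)
    × (t 2 3 3 (8 * m + 6) ≡ 2 * t 1 3 3 m)
    × (t 2 3 3 (32 * m + 27) ≡ 4 * t 1 3 3 m))
    × ((n : ℕ) → NonZero n → n % 16 ≢ 15 →
    ((n % 4 ≡ 0 ⊎ n % 4 ≡ 1) → t 2 3 3 n ≡ 4 * N 1 3 3 (n + 1))
    × (n % 8 ≡ 2 → t 2 3 3 n ≡ 2 * N 1 3 3 (n + 1))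
    × ((n % 8 ≡ 6 ⊎ n % 32 ≡ 27) → t 2 3 3 n ≡ N 1 3 3 (n + 1))
    × ((n % 16 ≡ 3 ⊎ n % 16 ≡ 7) → 5 * t 2 3 3 n ≡ 8 * N 1 3 3 (n + 1))
    × (n % 32 ≡ 11 → 3 * t 2 3 3 n ≡ 4 * N 1 3 3 (n + 1)))
theorem2p1 =
  (λ m → N-2-3-3-even m , t-8m+6 m , t-32m+27 m) ,
  λ n _ _ → subst (λ m →
      ((n % 4 ≡ 0 ⊎ n % 4 ≡ 1) → t 2 3 3 n ≡ 4 * N 1 3 3 m)
      × (n % 8 ≡ 2 → t 2 3 3 n ≡ 2 * N 1 3 3 m)
      × ((n % 8 ≡ 6 ⊎ n % 32 ≡ 27) → t 2 3 3 n ≡ N 1 3 3 m)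
      × ((n % 16 ≡ 3 ⊎ n % 16 ≡ 7) → 5 * t 2 3 3 n ≡ 8 * N 1 3 3 m)
      × (n % 32 ≡ 11 → 3 * t 2 3 3 n ≡ 4 * N 1 3 3 m))
    (ℕ.+-comm 1 n)
    (case-0-1 n , case-2 n , case-6-27 n , case-3-7 n , case-11 n)
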